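{- Let $m\geq 2$ and $n\geq 3$ be integers. The Drazin index of the adjacency matrix of the oriented Dutch windmill graph $D^m_n$ is $n-1$.
   Context: For integers $m\geq 1$, $n\geq 3$, the oriented Dutch windmill graph $D^m_n$ is the directed graph with vertex set $V=\{1,2,\ldots,m(n-1)+1\}$ whose directed edges $(a,b)$ are exactly: $(1,(k-1)(n-1)+2)$ for $k\in\{1,\ldots,m\}$; $((k-1)(n-1)+i,(k-1)(n-1)+i+1)$ for $k\in\{1,\ldots,m\}$ and $i\in\{2,\ldots,n-1\}$; and $((k-1)(n-1)+n,1)$ for $k\in\{1,\ldots,m\}$. Its adjacency matrix $M=(a_{ij})$ has $a_{ij}=1$ if $(i,j)$ is an edge and $0$ otherwise. The Drazin index $\operatorname{ind}(A)$ of a square matrix $A$ is the least nonnegative integer $k$ such that there is a matrix $X$ with $A^{k+1}X=A^k$, $XAX=X$, $AX=XA$; equivalently, the multiplicity of $0$ as a root of the minimal polynomial of $A$. -}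

module Defs where

open import Algebra.Apartness.Bundles using (HeytingCommutativeRing; HeytingField)
open import Algebra.Bundles using (CommutativeRing)
open import Data.Bool.Base using (if_then_else_)
open import Data.Fin.Base using (Fin; toℕ)
open import Data.Fin.Properties using (any?)
import Data.Fin.Properties as Fin
open import Data.Nat.Base using (ℕ; zero; suc; _+_; _*_; _∸_; _≤_)
open import Data.Nat.Properties using (_≟_; _≤?_)
open import Data.Product.Base using (∃; ∃-syntax; _×_)
open import Data.Sum.Base using (_⊎_)
open import Data.Vec.Functional using (Vector)
open import Level using (Level; 0ℓ; _⊔_)
open import Relation.Binary.Core using (Rel)
open import Relation.Binary.Definitions using (Decidable)
open import Relation.Binary.PropositionalEquality.Core using (_≡_)
open import Relation.Nullary.Decidable using (does; _×-dec_; _⊎-dec_)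

private
  variable
    N : ℕ

-- The edges of the windmill, on the vertex labels 1, 2, …, m(n-1)+1.
-- The blade index k ∈ {1,…,m} is represented by  k : Fin m  with  toℕ k
-- standing for k - 1;  i ∈ {2,…,n-1} is  i : Fin n  with  2 ≤ toℕ i.
LabelEdge : (m n : ℕ) → Rel ℕ 0ℓ
LabelEdge m n a b =
    (∃[ k ] a ≡ 1 × b ≡ toℕ {m} k * (n ∸ 1) + 2)
  ⊎ (∃[ k ] ∃[ i ] 2 ≤ toℕ {n} i
                 × a ≡ toℕ {m} k * (n ∸ 1) + toℕ i
                 × b ≡ toℕ {m} k * (n ∸ 1) + toℕ i + 1)
  ⊎ (∃[ k ] a ≡ toℕ {m} k * (n ∸ 1) + n × b ≡ 1)

labelEdge? : ∀ m n → Decidable (LabelEdge m n)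
labelEdge? m n a b =
  any? (λ k → (a ≟ 1) ×-dec (b ≟ toℕ k * (n ∸ 1) + 2))
  ⊎-dec any? (λ k → any? (λ i →
          (2 ≤? toℕ i) ×-dec (a ≟ toℕ k * (n ∸ 1) + toℕ i)
                       ×-dec (b ≟ toℕ k * (n ∸ 1) + toℕ i + 1)))
  ⊎-dec any? (λ k → (a ≟ toℕ k * (n ∸ 1) + n) ×-dec (b ≟ 1))

order : (m n : ℕ) → ℕ
order m n = m * (n ∸ 1) + 1

label : Fin N → ℕ
label v = suc (toℕ v)

DutchWindmill : (m n : ℕ) → Rel (Fin (order m n)) 0ℓ
DutchWindmill m n u v = LabelEdge m n (label u) (label v)

dutchWindmill? : ∀ m n → Decidable (DutchWindmill m n)
dutchWindmill? m n u v = labelEdge? m n (label u) (label v)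

module _ {c ℓ₁ ℓ₂ : Level} (F : HeytingField c ℓ₁ ℓ₂) where

  private
    module F = HeytingField F
    module R = CommutativeRing (HeytingCommutativeRing.commutativeRing F.heytingCommutativeRing)

  open import Algebra.Definitions.RawMonoid R.+-rawMonoid
    using (sum) renaming (_×_ to _·_)

  -- Over a classical field, _#_ is just the negation of _≈_.
  CharacteristicZero : Set ℓ₂
  CharacteristicZero = ∀ k → (suc k · F.1#) F.# F.0#

  Matrix : ℕ → Set c
  Matrix N = Vector (Vector F.Carrier N) N

  infix 4 _≋_
  _≋_ : Rel (Matrix N) ℓ₁
  A ≋ B = ∀ i j → A i j F.≈ B i j

  identity : Matrix N
  identity i j = if does (i Fin.≟ j) then F.1# else F.0#

  infixl 7 _⊛_
  _⊛_ : Matrix N → Matrix N → Matrix N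
  (A ⊛ B) i j = sum (λ k → A i k F.* B k j)

  infixr 8 _^^_
  _^^_ : Matrix N → ℕ → Matrix N
  A ^^ zero  = identity
  A ^^ suc k = A ⊛ A ^^ k

  adjacencyMatrix : {E : Rel (Fin N) 0ℓ} → Decidable E → Matrix N
  adjacencyMatrix E? i j = if does (E? i j) then F.1# else F.0#

  IsDrazinInverse : Matrix N → ℕ → Matrix N → Set ℓ₁
  IsDrazinInverse A k X =
    (A ^^ (k + 1) ⊛ X ≋ A ^^ k) × (X ⊛ A ⊛ X ≋ X) × (A ⊛ X ≋ X ⊛ A)

  IsDrazinIndex : Matrix N → ℕ → Set (c ⊔ ℓ₁)
  IsDrazinIndex A k =
    ∃ (IsDrazinInverse A k) × (∀ j → ∃ (IsDrazinInverse A j) → k ≤ j)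

{-# OPTIONS --safe #-}
-- Put p = n − 1. Multiplying a matrix C by the adjacency matrix A on the left
-- replaces the row of a blade vertex by the row of its only successor, and the
-- row of the hub by the sum of the rows of the m blade starts. So the row of
-- A^p C at position q of any blade is the hub row of A^q C, and the hub row of
-- A^n C is m times that of C. Hence A^(p+n) = m A^p, and m⁻¹ A^p is a Drazin
-- inverse for the exponent p. Conversely, A^(j+1) X = A^j with j < p gives
-- A^p X = A^(p-1). On the left all blade starts have the same row, but on the
-- right the row of a blade start is the unit vector of the end of its own blade.
module Submission where

open import Defs
open import Algebra.Apartness.Bundles using (HeytingCommutativeRing; HeytingField)
open import Algebra.Bundles using (CommutativeRing)
import Algebra.Properties.Ring as RingProperties
import Algebra.Properties.Semiring.Mult as SemiringMult
import Algebra.Properties.Semiring.Sum as SemiringSum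
open import Data.Bool.Base using (if_then_else_)
open import Data.Fin.Base using (Fin; zero; suc; toℕ; fromℕ; inject₁; cast; combine)
import Data.Fin.Properties as Fin
open import Data.Fin.Relation.Unary.Top using (view; ‵fromℕ; ‵inject₁; view-fromℕ; view-inject₁)
open import Data.Nat.Base using (ℕ; zero; suc; _+_; _*_; _∸_; _≤_; s≤s; z≤n)
import Data.Nat.Properties as ℕ
open import Data.Nat.Tactic.RingSolver using (solve-∀)
open import Data.Product.Base using (∃; ∃-syntax; _×_; _,_; proj₁; proj₂)
open import Data.Sum.Base using (inj₁; inj₂)
open import Function.Base using (_∘_)
open import Function.Definitions using (Injective)
open import Level using (0ℓ)
open import Relation.Binary.Bundles using (Setoid)
open import Relation.Binary.Core using (Rel)
open import Relation.Binary.Definitions using (Decidable)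
open import Relation.Binary.PropositionalEquality.Core as ≡ using (_≡_; _≢_; cong)
import Relation.Binary.PropositionalEquality.Properties as ≡
import Relation.Binary.Reasoning.Setoid as SetoidReasoning
open import Relation.Nullary.Decidable using (yes; no; does)
open import Relation.Nullary.Negation using (¬_; contradiction)

-- Hub, blades and successors in the windmill graph.

module Blades (m l : ℕ) where

  Vertex : Set
  Vertex = Fin (order m (2 + l))

  -- `order` adds its 1 on the right, so no constructor of `Fin` shows. Casting from
  -- `Fin (1 + m * suc l)` exposes `zero` as the hub and leaves the rest to `combine`.
  hub : Vertex
  hub = cast (ℕ.+-comm 1 (m * suc l)) zero

  -- Here `l` is n - 2, so a blade has `suc l` vertices apart from the hub. Positions count from 0,
  -- so `q` stands for the index i = `2 + toℕ q` of the label.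
  blade : Fin m → Fin (suc l) → Vertex
  blade k q = cast (ℕ.+-comm 1 (m * suc l)) (suc (combine k q))

  -- The cast blocks pattern matching on a vertex, so the case split is done on its preimage under
  -- the cast and transported back.
  vertex-elim : ∀ {a} (P : Vertex → Set a) → P hub → (∀ k q → P (blade k q)) → ∀ u → P u
  vertex-elim P Phub Pblade u =
    ≡.subst P (Fin.cast-involutive eq (≡.sym eq) u) (go (cast (≡.sym eq) u))
    where
    eq : suc (m * suc l) ≡ m * suc l + 1
    eq = ℕ.+-comm 1 (m * suc l)
    go : ∀ w → P (cast eq w)
    go zero = Phub
    go (suc w) with Fin.combine-surjective {m} {suc l} w
    ... | k , q , ≡.refl = Pblade k q

  label-injective : {u v : Vertex} → label u ≡ label v → u ≡ v
  label-injective = Fin.toℕ-injective ∘ ℕ.suc-injective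

  label-hub : label hub ≡ 1
  label-hub = cong suc (Fin.toℕ-cast _ zero)

  label-blade : ∀ k q → label (blade k q) ≡ toℕ k * suc l + (2 + toℕ q)
  label-blade k q = begin
    suc (toℕ (blade k q))             ≡⟨ cong suc (Fin.toℕ-cast _ (suc (combine k q))) ⟩
    2 + toℕ (combine k q)             ≡⟨ cong (2 +_) (Fin.toℕ-combine k q) ⟩
    2 + (suc l * toℕ k + toℕ q)       ≡⟨ rearrange (toℕ k) l (toℕ q) ⟩
    toℕ k * suc l + (2 + toℕ q)       ∎
    where
    open ≡.≡-Reasoning
    rearrange : ∀ x y z → 2 + (suc y * x + z) ≡ x * suc y + (2 + z)
    rearrange = solve-∀

  label-start : ∀ k → label (blade k zero) ≡ toℕ k * suc l + 2
  label-start k = label-blade k zero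

  label-end : ∀ k → label (blade k (fromℕ l)) ≡ toℕ k * suc l + (2 + l)
  label-end k =
    ≡.trans (label-blade k (fromℕ l)) (cong (λ x → toℕ k * suc l + (2 + x)) (Fin.toℕ-fromℕ l))

  label-inject₁ : ∀ k (q : Fin l) → label (blade k (inject₁ q)) ≡ toℕ k * suc l + (2 + toℕ q)
  label-inject₁ k q = ≡.trans (label-blade k (inject₁ q))
    (cong (λ x → toℕ k * suc l + (2 + x)) (Fin.toℕ-inject₁ q))

  label-suc : ∀ k (q : Fin l) → label (blade k (suc q)) ≡ toℕ k * suc l + (2 + toℕ q) + 1
  label-suc k q = ≡.trans (label-blade k (suc q)) (rearrange (toℕ k * suc l) (toℕ q))
    where
    rearrange : ∀ x y → x + (3 + y) ≡ x + (2 + y) + 1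
    rearrange = solve-∀

  blade-injective : ∀ {k q k′ q′} → blade k q ≡ blade k′ q′ → k ≡ k′ × q ≡ q′
  blade-injective {k} {q} {k′} {q′} eq =
    Fin.combine-injective k q k′ q′ (Fin.toℕ-injective (ℕ.suc-injective (begin
      toℕ (suc (combine k q))    ≡⟨ Fin.toℕ-cast _ (suc (combine k q)) ⟨
      toℕ (blade k q)            ≡⟨ cong toℕ eq ⟩
      toℕ (blade k′ q′)          ≡⟨ Fin.toℕ-cast _ (suc (combine k′ q′)) ⟩
      toℕ (suc (combine k′ q′))  ∎)))
    where open ≡.≡-Reasoning

  -- This separates the hub, labelled 1, from the blades: it rules out edges of the wrong kind in
  -- both successor lemmas.
  blade-label≢1 : ∀ {x y} → x + (2 + y) ≢ 1
  blade-label≢1 {x} {y} eq rewrite ℕ.+-suc x (suc y) | ℕ.+-suc x y with () ← eq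

  E : Rel Vertex 0ℓ
  E = DutchWindmill m (2 + l)

  hub→start : ∀ k → E hub (blade k zero)
  hub→start k = inj₁ (k , label-hub , label-start k)

  hub-successor : ∀ v → E hub v → ∃[ k ] v ≡ blade k zero
  hub-successor v (inj₁ (k , _ , b≡)) = k , label-injective (≡.trans b≡ (≡.sym (label-start k)))
  hub-successor v (inj₂ (inj₁ (k , i , 2≤i , a≡ , _))) with toℕ i
  hub-successor v (inj₂ (inj₁ (k , i , s≤s (s≤s z≤n) , a≡ , _))) | suc (suc i′) =
    contradiction (≡.trans (≡.sym a≡) label-hub) blade-label≢1
  hub-successor v (inj₂ (inj₂ (k , a≡ , _))) =
    contradiction (≡.trans (≡.sym a≡) label-hub) blade-label≢1

  next : Fin m → Fin (suc l) → Vertex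
  next k q with view q
  ... | ‵fromℕ     = hub
  ... | ‵inject₁ r = blade k (suc r)

  next-inject₁ : ∀ k (q : Fin l) → next k (inject₁ q) ≡ blade k (suc q)
  next-inject₁ k q rewrite view-inject₁ q = ≡.refl

  next-fromℕ : ∀ k → next k (fromℕ l) ≡ hub
  next-fromℕ k rewrite view-fromℕ l = ≡.refl

  blade→next : ∀ k q → E (blade k q) (next k q)
  blade→next k q with view q
  ... | ‵fromℕ     = inj₂ (inj₂ (k , label-end k , label-hub))
  ... | ‵inject₁ r =
    inj₂ (inj₁ (k , suc (suc r) , s≤s (s≤s z≤n) , label-inject₁ k r , label-suc k r))

  -- A label determines its blade and position, so the source of the edge fixes which kind of edge
  -- it is and hence its target.
  blade-successor : ∀ {k q} v → E (blade k q) v → v ≡ next k q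
  blade-successor {k} {q} v (inj₁ (_ , a≡ , _)) =
    contradiction (≡.trans (≡.sym (label-blade k q)) a≡) blade-label≢1
  blade-successor v (inj₂ (inj₁ (k′ , suc zero , s≤s () , _)))
  -- Once i < 2 is excluded, the remainder lies in `Fin l`, so the source is a position `inject₁ i`
  -- before the end of the blade.
  blade-successor v (inj₂ (inj₁ (k′ , suc (suc i) , _ , a≡ , b≡)))
    with ≡.refl , ≡.refl ←
      blade-injective (label-injective (≡.trans a≡ (≡.sym (label-inject₁ k′ i)))) =
    ≡.trans (label-injective (≡.trans b≡ (≡.sym (label-suc k′ i)))) (≡.sym (next-inject₁ k′ i))
  blade-successor v (inj₂ (inj₂ (k′ , a≡ , b≡)))
    with ≡.refl , ≡.refl ←
      blade-injective (label-injective (≡.trans a≡ (≡.sym (label-end k′)))) =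
    ≡.trans (label-injective (≡.trans b≡ (≡.sym label-hub))) (≡.sym (next-fromℕ k′))

-- Finite sums and products with adjacency matrices.

module Matrices {c ℓ₁ ℓ₂} (F : HeytingField c ℓ₁ ℓ₂) where

  private
    commutativeRing : CommutativeRing c ℓ₁
    commutativeRing = HeytingCommutativeRing.commutativeRing (HeytingField.heytingCommutativeRing F)

  open CommutativeRing commutativeRing public
    renaming (_+_ to _⊞_; _*_ to _⊠_)
    hiding (zero; _-_)
  open SemiringSum semiring public
  open SemiringMult semiring public renaming (_×_ to _·_)

  private
    variable
      N r : ℕ

  infix 4 _≃_
  infixl 7 _⊗_
  infixr 8 _^_
  infixr 7 _•_

  _≃_ : Matrix F N → Matrix F N → Set ℓ₁
  _≃_ = _≋_ F

  _⊗_ : Matrix F N → Matrix F N → Matrix F N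
  _⊗_ = _⊛_ F

  _^_ : Matrix F N → ℕ → Matrix F N
  _^_ = _^^_ F

  _•_ : Carrier → Matrix F N → Matrix F N
  (s • A) i j = s ⊠ A i j

  sum-zero : {g : Fin N → Carrier} → (∀ j → g j ≈ 0#) → sum g ≈ 0#
  sum-zero {N} g≈0 = trans (sum-cong-≋ g≈0) (sum-replicate-zero N)

  sum-singleton : (g : Fin N → Carrier) (i : Fin N) → (∀ j → j ≢ i → g j ≈ 0#) → sum g ≈ g i
  sum-singleton g zero    g≈0 =
    trans (+-congˡ (sum-zero (λ j → g≈0 (suc j) λ ()))) (+-identityʳ (g zero))
  sum-singleton g (suc i) g≈0 =
    trans (+-cong (g≈0 zero λ ()) (sum-singleton (g ∘ suc) i
            (λ j j≢i → g≈0 (suc j) (j≢i ∘ Fin.suc-injective))))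
          (+-identityˡ (g (suc i)))

  -- Insert the sum over k of the indicator of σ k ≡ j and exchange the sums.
  sum-image : (g : Fin N → Carrier) (σ : Fin r → Fin N) → Injective _≡_ _≡_ σ →
              (∀ j → (∀ k → j ≢ σ k) → g j ≈ 0#) → sum g ≈ sum (g ∘ σ)
  sum-image {N} {r} g σ σ-injective g≈0 = begin
    sum g                               ≈⟨ sum-cong-≋ columns ⟨
    ∑[ j < N ] ∑[ k < r ] h j k         ≈⟨ ∑-comm h ⟩
    ∑[ k < r ] ∑[ j < N ] h j k         ≈⟨ sum-cong-≋ rows ⟩
    sum (g ∘ σ)                         ∎
    where
    open SetoidReasoning setoid

    h : Fin N → Fin r → Carrier
    h j k = if does (j Fin.≟ σ k) then g j else 0#

    h-on : ∀ {j k} → j ≡ σ k → h j k ≈ g j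
    h-on {j} {k} eq with j Fin.≟ σ k
    ... | yes _   = refl
    ... | no j≢σk = contradiction eq j≢σk

    h-off : ∀ {j k} → j ≢ σ k → h j k ≈ 0#
    h-off {j} {k} j≢σk with j Fin.≟ σ k
    ... | yes eq = contradiction eq j≢σk
    ... | no _   = refl

    rows : ∀ k → sum (λ j → h j k) ≈ g (σ k)
    rows k = trans (sum-singleton (λ j → h j k) (σ k) (λ j → h-off)) (h-on ≡.refl)

    columns : ∀ j → sum (h j) ≈ g j
    columns j with Fin.any? (λ k → j Fin.≟ σ k)
    ... | yes (k , j≡σk) = trans
      (sum-singleton (h j) k (λ k′ k′≢k → h-off (λ j≡σk′ →
        k′≢k (σ-injective (≡.trans (≡.sym j≡σk′) j≡σk)))))
      (h-on j≡σk)
    ... | no ∄k = trans (sum-zero (λ k → h-off (λ j≡σk → ∄k (k , j≡σk))))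
                        (sym (g≈0 j (λ k j≡σk → ∄k (k , j≡σk))))

  module _ {E : Rel (Fin N) 0ℓ} (E? : Decidable E) where

    adjacent : ∀ {i j} → E i j → adjacencyMatrix F E? i j ≈ 1#
    adjacent {i} {j} e with E? i j
    ... | yes _ = refl
    ... | no ¬e = contradiction e ¬e

    nonadjacent : ∀ {i j} → ¬ E i j → adjacencyMatrix F E? i j ≈ 0#
    nonadjacent {i} {j} ¬e with E? i j
    ... | yes e = contradiction e ¬e
    ... | no _  = refl

    -- Non-successors of `i` contribute 0, and `σ` lists each successor once with coefficient 1.
    -- Through this lemma the graph enters the matrix computations.
    adjacency-row : (B : Matrix F N) (i : Fin N) (σ : Fin r → Fin N) → Injective _≡_ _≡_ σ →
                    (∀ k → E i (σ k)) → (∀ j → E i j → ∃[ k ] j ≡ σ k) →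
                    ∀ c → (adjacencyMatrix F E? ⊗ B) i c ≈ ∑[ k < r ] B (σ k) c
    adjacency-row B i σ σ-injective i→σ i→ c = trans
      (sum-image _ σ σ-injective (λ j j≢σ →
        trans (*-congʳ (nonadjacent (λ e → j≢σ _ (proj₂ (i→ j e))))) (zeroˡ _)))
      (sum-cong-≋ (λ k → trans (*-congʳ (adjacent (i→σ k))) (*-identityˡ _)))

    adjacency-row₁ : (B : Matrix F N) (i v : Fin N) → E i v → (∀ j → E i j → j ≡ v) →
                     ∀ c → (adjacencyMatrix F E? ⊗ B) i c ≈ B v c
    adjacency-row₁ B i v i→v i→ c = trans
      (adjacency-row {r = 1} B i (λ _ → v) (λ { {zero} {zero} _ → ≡.refl })
        (λ _ → i→v) (λ j e → zero , i→ j e) c)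
      (+-identityʳ _)

  -- Laws of matrix products, scalars and powers.

  ⊗-cong : {A A′ B B′ : Matrix F N} → A ≃ A′ → B ≃ B′ → A ⊗ B ≃ A′ ⊗ B′
  ⊗-cong A≃A′ B≃B′ i j = sum-cong-≋ (λ k → *-cong (A≃A′ i k) (B≃B′ k j))

  ⊗-assoc : (A B C : Matrix F N) → (A ⊗ B) ⊗ C ≃ A ⊗ (B ⊗ C)
  ⊗-assoc {N} A B C i j = begin
    ∑[ k < N ] (sum (λ h → A i h ⊠ B h k) ⊠ C k j)
      ≈⟨ sum-cong-≋ (λ k → *-distribʳ-sum (C k j) (λ h → A i h ⊠ B h k)) ⟩
    ∑[ k < N ] ∑[ h < N ] (A i h ⊠ B h k ⊠ C k j)
      ≈⟨ ∑-comm (λ k h → A i h ⊠ B h k ⊠ C k j) ⟩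
    ∑[ h < N ] ∑[ k < N ] (A i h ⊠ B h k ⊠ C k j)
      ≈⟨ sum-cong-≋ (λ h → sum-cong-≋ (λ k → *-assoc (A i h) (B h k) (C k j))) ⟩
    ∑[ h < N ] ∑[ k < N ] (A i h ⊠ (B h k ⊠ C k j))
      ≈⟨ sum-cong-≋ (λ h → *-distribˡ-sum (A i h) (λ k → B h k ⊠ C k j)) ⟨
    ∑[ h < N ] (A i h ⊠ sum (λ k → B h k ⊠ C k j))
      ∎
    where open SetoidReasoning setoid

  -- The identity matrix is, definitionally, the adjacency matrix of _≡_.
  ⊗-identityˡ : (A : Matrix F N) → identity F ⊗ A ≃ A
  ⊗-identityˡ A i = adjacency-row₁ Fin._≟_ A i i ≡.refl (λ _ → ≡.sym)

  ⊗-identityʳ : (A : Matrix F N) → A ⊗ identity F ≃ A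
  ⊗-identityʳ A i j = trans
    (sum-singleton _ j (λ k k≢j → trans (*-congˡ (nonadjacent Fin._≟_ k≢j)) (zeroʳ _)))
    (trans (*-congˡ (adjacent Fin._≟_ {j} ≡.refl)) (*-identityʳ _))

  •-⊗ : (s : Carrier) (A B : Matrix F N) → (s • A) ⊗ B ≃ s • (A ⊗ B)
  •-⊗ s A B i j = trans
    (sum-cong-≋ (λ k → *-assoc s (A i k) (B k j)))
    (sym (*-distribˡ-sum s (λ k → A i k ⊠ B k j)))

  ⊗-• : (s : Carrier) (A B : Matrix F N) → A ⊗ (s • B) ≃ s • (A ⊗ B)
  ⊗-• s A B i j = trans
    (sum-cong-≋ (λ k → x∙yz≈y∙xz (A i k) s (B k j)))
    (sym (*-distribˡ-sum s (λ k → A i k ⊠ B k j)))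
    where open import Algebra.Properties.CommutativeSemigroup *-commutativeSemigroup using (x∙yz≈y∙xz)

  ≃-setoid : ℕ → Setoid c ℓ₁
  ≃-setoid N = record
    { Carrier       = Matrix F N
    ; _≈_           = _≃_
    ; isEquivalence = record
      { refl  = λ i j → refl
      ; sym   = λ A≃B i j → sym (A≃B i j)
      ; trans = λ A≃B B≃C i j → trans (A≃B i j) (B≃C i j)
      }
    }

  module _ {N : ℕ} where
    open Setoid (≃-setoid N) public
      using () renaming (refl to ≃-refl; sym to ≃-sym; trans to ≃-trans)

  module ≃-Reasoning {N : ℕ} = SetoidReasoning (≃-setoid N)

  ⊗-congˡ : {A B B′ : Matrix F N} → B ≃ B′ → A ⊗ B ≃ A ⊗ B′
  ⊗-congˡ {A = A} = ⊗-cong (≃-refl {x = A})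

  ⊗-congʳ : {A A′ B : Matrix F N} → A ≃ A′ → A ⊗ B ≃ A′ ⊗ B
  ⊗-congʳ {B = B} A≃A′ = ⊗-cong A≃A′ (≃-refl {x = B})

  •-cong : {s : Carrier} {A B : Matrix F N} → A ≃ B → s • A ≃ s • B
  •-cong A≃B i j = *-congˡ (A≃B i j)

  •-inverse : {s t : Carrier} {A : Matrix F N} → s ⊠ t ≈ 1# → s • (t • A) ≃ A
  •-inverse st≈1 i j = trans (sym (*-assoc _ _ _)) (trans (*-congʳ st≈1) (*-identityˡ _))

  ^-≡ : (A : Matrix F N) {a b : ℕ} → a ≡ b → A ^ a ≃ A ^ b
  ^-≡ A ≡.refl = ≃-refl

  ^-+ : (A : Matrix F N) (a b : ℕ) → A ^ (a + b) ≃ A ^ a ⊗ A ^ b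
  ^-+ A zero    b = ≃-sym (⊗-identityˡ (A ^ b))
  ^-+ A (suc a) b = ≃-trans (⊗-congˡ {A = A} (^-+ A a b)) (≃-sym (⊗-assoc A (A ^ a) (A ^ b)))

  ^-+-⊗ : (A : Matrix F N) (a b : ℕ) (B : Matrix F N) → A ^ (a + b) ⊗ B ≃ A ^ a ⊗ (A ^ b ⊗ B)
  ^-+-⊗ A a b B = ≃-trans (⊗-congʳ {B = B} (^-+ A a b)) (⊗-assoc (A ^ a) (A ^ b) B)

  ^-suc : (A : Matrix F N) (a : ℕ) → A ^ suc a ≃ A ^ a ⊗ A
  ^-suc A a = begin
    A ^ suc a      ≈⟨ ^-≡ A (ℕ.+-comm 1 a) ⟩
    A ^ (a + 1)    ≈⟨ ^-+ A a 1 ⟩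
    A ^ a ⊗ A ^ 1  ≈⟨ ⊗-congˡ {A = A ^ a} (⊗-identityʳ A) ⟩
    A ^ a ⊗ A      ∎
    where open ≃-Reasoning

  -- The first two Drazin equations both produce the exponent 2p + 1, once as (p + 1) + p and once
  -- as p + 1 + p around the middle factor; `cancel` then lowers it to p. The third holds because
  -- powers of `A` commute with `A`.
  periodic⇒drazinInverse : (A : Matrix F N) (p : ℕ) {s t : Carrier} → s ⊠ t ≈ 1# →
                           A ^ (p + suc p) ≃ t • A ^ p → IsDrazinInverse F A p (s • A ^ p)
  periodic⇒drazinInverse A p {s} {t} st≈1 period = absorbs , outer , commutes
    where
    open ≃-Reasoning

    cancel : s • A ^ (p + suc p) ≃ A ^ p
    cancel = ≃-trans (•-cong period) (•-inverse st≈1)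

    absorbs : A ^ (p + 1) ⊗ (s • A ^ p) ≃ A ^ p
    absorbs = begin
      A ^ (p + 1) ⊗ (s • A ^ p)    ≈⟨ ⊗-• s (A ^ (p + 1)) (A ^ p) ⟩
      s • (A ^ (p + 1) ⊗ A ^ p)    ≈⟨ •-cong (^-+ A (p + 1) p) ⟨
      s • A ^ (p + 1 + p)          ≈⟨ •-cong (^-≡ A (ℕ.+-assoc p 1 p)) ⟩
      s • A ^ (p + suc p)          ≈⟨ cancel ⟩
      A ^ p                        ∎

    outer : (s • A ^ p) ⊗ A ⊗ (s • A ^ p) ≃ s • A ^ p
    outer = begin
      (s • A ^ p) ⊗ A ⊗ (s • A ^ p)    ≈⟨ ⊗-assoc (s • A ^ p) A (s • A ^ p) ⟩
      (s • A ^ p) ⊗ (A ⊗ (s • A ^ p))  ≈⟨ •-⊗ s (A ^ p) (A ⊗ (s • A ^ p)) ⟩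
      s • (A ^ p ⊗ (A ⊗ (s • A ^ p)))  ≈⟨ •-cong (⊗-congˡ {A = A ^ p} (⊗-• s A (A ^ p))) ⟩
      s • (A ^ p ⊗ (s • A ^ suc p))    ≈⟨ •-cong (⊗-• s (A ^ p) (A ^ suc p)) ⟩
      s • (s • (A ^ p ⊗ A ^ suc p))    ≈⟨ •-cong (•-cong (^-+ A p (suc p))) ⟨
      s • (s • A ^ (p + suc p))        ≈⟨ •-cong cancel ⟩
      s • A ^ p                        ∎

    commutes : A ⊗ (s • A ^ p) ≃ (s • A ^ p) ⊗ A
    commutes = begin
      A ⊗ (s • A ^ p)    ≈⟨ ⊗-• s A (A ^ p) ⟩
      s • A ^ suc p      ≈⟨ •-cong (^-suc A p) ⟩
      s • (A ^ p ⊗ A)    ≈⟨ •-⊗ s (A ^ p) A ⟨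
      (s • A ^ p) ⊗ A    ∎

-- Rows of powers of the windmill's adjacency matrix.

module Windmill {c ℓ₁ ℓ₂} (F : HeytingField c ℓ₁ ℓ₂) (m l : ℕ) where

  open Blades m l
  open Matrices F
  open SetoidReasoning setoid

  A : Matrix F (order m (2 + l))
  A = adjacencyMatrix F (dutchWindmill? m (2 + l))

  hub-row : ∀ B v → (A ⊗ B) hub v ≈ ∑[ k < m ] B (blade k zero) v
  hub-row B = adjacency-row (dutchWindmill? m (2 + l)) B hub (λ k → blade k zero)
    (proj₁ ∘ blade-injective) hub→start hub-successor

  next-row : ∀ B k q v → (A ⊗ B) (blade k q) v ≈ B (next k q) v
  next-row B k q = adjacency-row₁ (dutchWindmill? m (2 + l)) B (blade k q) (next k q)
    (blade→next k q) blade-successor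

  inject₁-row : ∀ B k q v → (A ⊗ B) (blade k (inject₁ q)) v ≈ B (blade k (suc q)) v
  inject₁-row B k q v =
    ≡.subst (λ w → (A ⊗ B) (blade k (inject₁ q)) v ≈ B w v) (next-inject₁ k q)
      (next-row B k (inject₁ q) v)

  end-row : ∀ B k v → (A ⊗ B) (blade k (fromℕ l)) v ≈ B hub v
  end-row B k v =
    ≡.subst (λ w → (A ⊗ B) (blade k (fromℕ l)) v ≈ B w v) (next-fromℕ k)
      (next-row B k (fromℕ l) v)

  -- Before the end of a blade every vertex has one successor, so each factor `A` moves the row
  -- index one position on. The equation makes the factors run out exactly at the end.
  walk-to-end : ∀ B k q d → toℕ q + d ≡ l →
                ∀ v → (A ^ d ⊗ B) (blade k q) v ≈ B (blade k (fromℕ l)) v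
  walk-to-end B k q d eq v with view q
  walk-to-end B k _ zero    eq v | ‵fromℕ     = ⊗-identityˡ B (blade k (fromℕ l)) v
  walk-to-end B k _ (suc d) eq v | ‵fromℕ     =
    contradiction (≡.trans (cong (_+ suc d) (≡.sym (Fin.toℕ-fromℕ l))) eq) (ℕ.m+1+n≢m l)
  walk-to-end B k _ zero    eq v | ‵inject₁ q =
    contradiction (≡.trans (≡.sym (Fin.toℕ-inject₁ q)) (≡.trans (≡.sym (ℕ.+-identityʳ _)) eq))
      (ℕ.<⇒≢ (Fin.toℕ<n q))
  walk-to-end B k _ (suc d) eq v | ‵inject₁ q = begin
    (A ^ suc d ⊗ B) (blade k (inject₁ q)) v     ≈⟨ ⊗-assoc A (A ^ d) B (blade k (inject₁ q)) v ⟩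
    (A ⊗ (A ^ d ⊗ B)) (blade k (inject₁ q)) v   ≈⟨ inject₁-row (A ^ d ⊗ B) k q v ⟩
    (A ^ d ⊗ B) (blade k (suc q)) v             ≈⟨ walk-to-end B k (suc q) d eq′ v ⟩
    B (blade k (fromℕ l)) v                     ∎
    where
    eq′ : suc (toℕ q) + d ≡ l
    eq′ = ≡.trans (≡.sym (ℕ.+-suc (toℕ q) d))
                  (≡.trans (cong (_+ suc d) (≡.sym (Fin.toℕ-inject₁ q))) eq)

  -- Of the `suc l` factors, `l ∸ toℕ q` lead to the end of the blade and one more to the hub, which
  -- leaves `toℕ q` of them.
  blade-row : ∀ B k q v → (A ^ suc l ⊗ B) (blade k q) v ≈ (A ^ toℕ q ⊗ B) hub v
  blade-row B k q v = begin
    (A ^ suc l ⊗ B) (blade k q) v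
      ≈⟨ ⊗-congʳ {B = B} (^-≡ A steps) (blade k q) v ⟩
    (A ^ (d + suc (toℕ q)) ⊗ B) (blade k q) v
      ≈⟨ ^-+-⊗ A d (suc (toℕ q)) B (blade k q) v ⟩
    (A ^ d ⊗ (A ^ suc (toℕ q) ⊗ B)) (blade k q) v
      ≈⟨ walk-to-end (A ^ suc (toℕ q) ⊗ B) k q d (ℕ.m+[n∸m]≡n (Fin.toℕ≤pred[n] q)) v ⟩
    (A ^ suc (toℕ q) ⊗ B) (blade k (fromℕ l)) v
      ≈⟨ ⊗-assoc A (A ^ toℕ q) B (blade k (fromℕ l)) v ⟩
    (A ⊗ (A ^ toℕ q ⊗ B)) (blade k (fromℕ l)) v
      ≈⟨ end-row (A ^ toℕ q ⊗ B) k v ⟩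
    (A ^ toℕ q ⊗ B) hub v
      ∎
    where
    d : ℕ
    d = l ∸ toℕ q
    steps : suc l ≡ d + suc (toℕ q)
    steps = ≡.trans (cong suc (≡.sym (ℕ.m∸n+n≡m (Fin.toℕ≤pred[n] q)))) (≡.sym (ℕ.+-suc d (toℕ q)))

  start-row : ∀ B k v → (A ^ suc l ⊗ B) (blade k zero) v ≈ B hub v
  start-row B k v = trans (blade-row B k zero v) (⊗-identityˡ B hub v)

  -- One factor branches from the hub to the m blade starts, and the other `suc l` bring every
  -- branch back to the hub.
  hub-return : ∀ B v → (A ^ (2 + l) ⊗ B) hub v ≈ (m · 1#) ⊠ B hub v
  hub-return B v = begin
    (A ^ (2 + l) ⊗ B) hub v                         ≈⟨ ⊗-assoc A (A ^ suc l) B hub v ⟩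
    (A ⊗ (A ^ suc l ⊗ B)) hub v                     ≈⟨ hub-row (A ^ suc l ⊗ B) v ⟩
    ∑[ k < m ] (A ^ suc l ⊗ B) (blade k zero) v     ≈⟨ sum-cong-≋ (λ k → start-row B k v) ⟩
    ∑[ k < m ] B hub v                              ≈⟨ sum-replicate m ⟩
    -- The m-fold sum becomes multiplication by the field element `m · 1#`, which can be inverted in
    -- characteristic zero.
    m · B hub v                                     ≈⟨ ×-congʳ m (*-identityˡ (B hub v)) ⟨
    m · (1# ⊠ B hub v)                              ≈⟨ ×-assoc-* m 1# (B hub v) ⟨
    (m · 1#) ⊠ B hub v                              ∎

  hub-return-^ : ∀ a v → (A ^ (a + (2 + l))) hub v ≈ (m · 1#) ⊠ (A ^ a) hub v
  hub-return-^ a v = begin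
    (A ^ (a + (2 + l))) hub v        ≈⟨ ^-≡ A (ℕ.+-comm a (2 + l)) hub v ⟩
    (A ^ (2 + l + a)) hub v          ≈⟨ ^-+ A (2 + l) a hub v ⟩
    (A ^ (2 + l) ⊗ A ^ a) hub v      ≈⟨ hub-return (A ^ a) v ⟩
    (m · 1#) ⊠ (A ^ a) hub v         ∎

  period : A ^ (suc l + (2 + l)) ≃ (m · 1#) • A ^ suc l
  period = vertex-elim (λ u → ∀ v → (A ^ (suc l + (2 + l))) u v ≈ (m · 1#) ⊠ (A ^ suc l) u v)
    (hub-return-^ (suc l))
    λ k q v → begin
      (A ^ (suc l + (2 + l))) (blade k q) v           ≈⟨ ^-+ A (suc l) (2 + l) (blade k q) v ⟩
      (A ^ suc l ⊗ A ^ (2 + l)) (blade k q) v         ≈⟨ blade-row (A ^ (2 + l)) k q v ⟩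
      (A ^ toℕ q ⊗ A ^ (2 + l)) hub v                 ≈⟨ ^-+ A (toℕ q) (2 + l) hub v ⟨
      (A ^ (toℕ q + (2 + l))) hub v                   ≈⟨ hub-return-^ (toℕ q) v ⟩
      -- The identity factor brings the power into the product form of `blade-row`, which is then
      -- read backwards.
      (m · 1#) ⊠ (A ^ toℕ q) hub v                    ≈⟨ *-congˡ (⊗-identityʳ (A ^ toℕ q) hub v) ⟨
      (m · 1#) ⊠ (A ^ toℕ q ⊗ identity F) hub v       ≈⟨ *-congˡ (blade-row (identity F) k q v) ⟨
      (m · 1#) ⊠ (A ^ suc l ⊗ identity F) (blade k q) v
        ≈⟨ *-congˡ (⊗-identityʳ (A ^ suc l) (blade k q) v) ⟩
      (m · 1#) ⊠ (A ^ suc l) (blade k q) v            ∎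

  -- Both sides come from the row of the blade start in `A ^ l`. The point is that `X hub v` does
  -- not mention `k`.
  end-unit-vector : ∀ {j} X → A ^ (j + 1) ⊗ X ≃ A ^ j → j ≤ l →
                    ∀ k v → identity F (blade k (fromℕ l)) v ≈ X hub v
  end-unit-vector {j} X eq j≤l k v = begin
    identity F (blade k (fromℕ l)) v                 ≈⟨ walk-to-end (identity F) k zero l ≡.refl v ⟨
    (A ^ l ⊗ identity F) (blade k zero) v            ≈⟨ ⊗-identityʳ (A ^ l) (blade k zero) v ⟩
    -- Multiplying the hypothesis on the left by `A ^ (l ∸ j)` raises its exponents from j and j + 1
    -- to `l` and `suc l`.
    (A ^ l) (blade k zero) v                         ≈⟨ ^-≡ A (ℕ.m∸n+n≡m j≤l) (blade k zero) v ⟨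
    (A ^ (d + j)) (blade k zero) v                   ≈⟨ ^-+ A d j (blade k zero) v ⟩
    (A ^ d ⊗ A ^ j) (blade k zero) v                 ≈⟨ ⊗-congˡ {A = A ^ d} eq (blade k zero) v ⟨
    (A ^ d ⊗ (A ^ (j + 1) ⊗ X)) (blade k zero) v     ≈⟨ ^-+-⊗ A d (j + 1) X (blade k zero) v ⟨
    (A ^ (d + (j + 1)) ⊗ X) (blade k zero) v         ≈⟨ ⊗-congʳ {B = X} (^-≡ A steps) (blade k zero) v ⟩
    (A ^ suc l ⊗ X) (blade k zero) v                 ≈⟨ start-row X k v ⟩
    X hub v                                          ∎
    where
    d : ℕ
    d = l ∸ j
    steps : d + (j + 1) ≡ suc l
    steps = ≡.trans (≡.sym (ℕ.+-assoc d j 1))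
                    (≡.trans (ℕ.+-comm (d + j) 1) (cong suc (ℕ.m∸n+n≡m j≤l)))

  -- The unit vectors of two different blade ends would both be the hub row of `X`; they are
  -- compared in the column of one of these ends.
  small-exponent⇒trivial : ∀ {j} X → A ^ (j + 1) ⊗ X ≃ A ^ j → j ≤ l →
                           {k k′ : Fin m} → k ≢ k′ → 1# ≈ 0#
  small-exponent⇒trivial X eq j≤l {k} {k′} k≢k′ = begin
    1#                            ≈⟨ adjacent Fin._≟_ {end k} ≡.refl ⟨
    identity F (end k) (end k)    ≈⟨ end-unit-vector X eq j≤l k (end k) ⟩
    X hub (end k)                 ≈⟨ end-unit-vector X eq j≤l k′ (end k) ⟨
    identity F (end k′) (end k)   ≈⟨ nonadjacent Fin._≟_ (k≢k′ ∘ ≡.sym ∘ proj₁ ∘ blade-injective) ⟩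
    0#                            ∎
    where
    end : Fin m → Vertex
    end k = blade k (fromℕ l)

-- Apartness from zero, and the value of the index.

module _ {c ℓ₁ ℓ₂} (F : HeytingField c ℓ₁ ℓ₂) where

  open Matrices F
  open HeytingField F using (_#_; #⇒invertible; tight)
  open RingProperties ring using (-0#≈0#)

  -- The field axiom inverts the difference x - 0, which has to be rewritten as x.
  #0⇒inverse : ∀ {x} → x # 0# → ∃[ y ] y ⊠ x ≈ 1#
  #0⇒inverse {x} x#0 with y , y[x-0]≈1 , _ ← #⇒invertible x#0 =
    y , trans (*-congˡ (sym (trans (+-congˡ -0#≈0#) (+-identityʳ x)))) y[x-0]≈1

  #⇒≉ : ∀ {x y} → x # y → ¬ x ≈ y
  #⇒≉ x#y x≈y = proj₂ (tight _ _) x≈y x#y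

theorem3p2 : ∀ {c ℓ₁ ℓ₂} (F : HeytingField c ℓ₁ ℓ₂) → CharacteristicZero F → (m n : ℕ) → 2 ≤ m → 3 ≤ n → IsDrazinIndex F (adjacencyMatrix F (dutchWindmill? m n)) (n ∸ 1)
theorem3p2 F char0 m@(suc (suc m′)) (suc (suc l)) (s≤s (s≤s z≤n)) (s≤s (s≤s _)) =
  -- As m is `suc (suc m′)`, `char0 (suc m′)` says that `m · 1#` is apart from 0; its inverse is the
  -- scalar of the Drazin inverse.
  (_ , periodic⇒drazinInverse A (suc l) (proj₂ (#0⇒inverse F (char0 (suc m′)))) period) , minimal
  where
  open Matrices F
  open Windmill F m l

  minimal : ∀ j → ∃ (IsDrazinInverse F A j) → suc l ≤ j
  minimal j (X , eq , _) = ℕ.≰⇒> λ j≤l →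
    -- `char0 0` speaks of `1 · 1#`, which unfolds to 1 + 0. The blades `zero` and `suc zero` both
    -- exist since m is at least 2.
    #⇒≉ F (char0 0) (trans (+-identityʳ 1#)
      (small-exponent⇒trivial X eq j≤l {zero} {suc zero} λ ()))
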